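{- (Interpolation) Let $\phi=\phi(x)$ be a formula of $\Sigma^1_1(L_{\infty\omega}^{corr})$, $\psi=\psi(x)$ a formula of $\Pi^1_1(L_{\infty\omega}^{corr})$, and $K$ a class of Routley–Meyer structures axiomatizable by some sentence $\sigma$ of $L_{\infty\omega}^{corr}$. Then $\phi$ implies $\psi$ along relevant directed bisimulations for $\mathtt{PROP}_\phi\cap\mathtt{PROP}_\psi$ over $K$ if and only if there is a relevant interpolant $\theta$ for $\phi$ and $\psi$ over $K$ according to the standard consequence relation, with propositional variables in $\mathtt{PROP}_\phi\cap\mathtt{PROP}_\psi$; that is, a formula $\theta$ of $L_{\infty\omega}^{\rightarrow}$ whose propositional variables all lie in $\mathtt{PROP}_\phi\cap\mathtt{PROP}_\psi$ such that for every $M\in K$ and every world $w$ of $M$: if $M\vDash\phi[w]$ then $M,w\Vdash\theta$, and if $M,w\Vdash\theta$ then $M\vDash\psi[w]$.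
   Context: Language. Given a set $\mathtt{PROP}$ of propositional variables, the formulas of $L_{\infty\omega}^{\rightarrow}$ (infinitary relevant formulas) are generated by $\phi ::= p \mid \bot \mid {\sim}\phi \mid \bigwedge_{i\in I}\phi_i \mid \bigvee_{i\in I}\phi_i \mid \phi\rightarrow\psi$, with $p\in\mathtt{PROP}$ and $I$ an arbitrary set. Models. A (Routley–Meyer) model or structure is $M=\langle W,R,*,T,V\rangle$ with $W$ a non-empty set, $T\in W$, $*:W\to W$ (written $w\mapsto w^*$), $R\subseteq W^3$, and $V:\mathtt{PROP}\to\wp(W)$. Satisfaction: $M,w\Vdash\bot$ never; $M,w\Vdash p$ iff $w\in V(p)$; $M,w\Vdash{\sim}\phi$ iff $M,w^*\nVdash\phi$; $M,w\Vdash\bigwedge_{i\in I}\phi_i$ iff $M,w\Vdash\phi_i$ for every $i\in I$; $M,w\Vdash\bigvee_{i\in I}\phi_i$ iff $M,w\Vdash\phi_i$ for some $i\in I$; $M,w\Vdash\phi\rightarrow\psi$ iff for all $a,b$ with $Rwab$, if $M,a\Vdash\phi$ then $M,b\Vdash\psi$. Correspondence language. $L_{\infty\omega}^{corr}$ is the classical infinitary language with equality (arbitrary set-sized conjunctions and disjunctions, boolean negation, finitary quantification) in the signature with a constant $T$, a unary function symbol $*$, a ternary relation symbol $R$ and a unary predicate $P$ for each $p\in\mathtt{PROP}$. A model $M$ is read as a classical structure with domain $W$, interpreting $T,*,R$ in the obvious way and $P$ by $V(p)$; $M\vDash\chi[w]$ is Tarskian satisfaction with $w$ assigned to the free variable $x$.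 $\Sigma^1_1(L_{\infty\omega}^{corr})$ (resp. $\Pi^1_1(L_{\infty\omega}^{corr})$) is obtained by admitting existential (resp. universal) second-order quantifications in front of formulas of $L_{\infty\omega}^{corr}$. For a formula $\chi$, $\mathtt{PROP}_\chi$ is the collection of (non-quantified) predicates appearing in $\chi$ that correspond to propositional variables in $\mathtt{PROP}$, identified with the corresponding propositional variables. Relevant directed bisimulations. Let $M_1,M_2$ be models with components $W_m,R_m,*_m,V_m$ ($m=1,2$), and $\mathtt P\subseteq\mathtt{PROP}$. A relevant directed bisimulation for $\mathtt P$ between $M_1$ and $M_2$ is a pair $\langle Z_1,Z_2\rangle$ of non-empty relations $Z_1\subseteq W_1\times W_2$, $Z_2\subseteq W_2\times W_1$ such that whenever $\{i,j\}=\{1,2\}$: (1) $xZ_iy$ only if $y^{*_j}Z_jx^{*_i}$; (2) if $xZ_iy$ and $R_jybc$ for some $b,c\in W_j$, there are $b',c'\in W_i$ such that $R_ixb'c'$, $bZ_jb'$ and $c'Z_ic$; (3) if $xZ_iy$ and $p\in\mathtt P$, then $M_i,x\Vdash p$ only if $M_j,y\Vdash p$. $\phi$ implies $\psi$ along relevant directed bisimulations for $\mathtt P$ over $K$ if whenever $M_1,M_2\in K$, $\langle Z_1,Z_2\rangle$ is a relevant directed bisimulation for $\mathtt P$ between $M_1$ and $M_2$, $\{i,j\}=\{1,2\}$ and $aZ_ib$ (with $a\in W_i$, $b\in W_j$), then $M_i\vDash\phi[a]$ only if $M_j\vDash\psi[b]$. -}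

module Defs where

open import Level using (Level; _⊔_; suc)
open import Data.Nat.Base as ℕ using (ℕ)
open import Data.Fin.Base using (Fin)
open import Data.List.Base as List using (List; [])
open import Data.Vec.Base as Vec using (Vec; []; _∷_)
open import Data.Empty.Polymorphic using (⊥)
open import Data.Product.Base using (Σ-syntax; ∃; _×_)
open import Data.Sum.Base using (_⊎_)
open import Function.Bundles using (_⇔_)
open import Relation.Nullary.Negation.Core using (¬_)
open import Relation.Unary using (Pred; _∈_; _∩_; _⊆_)
open import Relation.Binary.Core using (REL)
open import Relation.Binary.Definitions using (NonEmpty)
open import Relation.Binary.PropositionalEquality.Core using (_≡_)

-- "Set" means a type in Set ℓ throughout: the propositional variables, the
-- index sets of ⋀ and ⋁, and the domains of models all live in Set ℓ.

private
  variable
    ℓ k : Level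

------------------------------------------------------------------------
-- Routley–Meyer models

-- The domain is non-empty because of T.

record Model (PROP : Set ℓ) : Set (suc ℓ) where
  field
    W    : Set ℓ
    R    : W → W → W → Set ℓ
    star : W → W
    T    : W
    V    : PROP → Pred W ℓ

open Model public using (W)

------------------------------------------------------------------------
-- Infinitary relevant formulas

infixr 5 _⟶_

data Relevant (PROP : Set ℓ) : Set (suc ℓ) where
  prop : PROP → Relevant PROP
  bot  : Relevant PROP
  ∼_   : Relevant PROP → Relevant PROP
  ⋀    : (I : Set ℓ) → (I → Relevant PROP) → Relevant PROP
  ⋁    : (I : Set ℓ) → (I → Relevant PROP) → Relevant PROP
  _⟶_  : Relevant PROP → Relevant PROP → Relevant PROP

infix 4 _,_⊩_

_,_⊩_ : {PROP : Set ℓ} (M : Model PROP) → W M → Relevant PROP → Set ℓ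
M , w ⊩ prop p  = w ∈ Model.V M p
M , w ⊩ bot     = ⊥
M , w ⊩ ∼ θ     = ¬ (M , Model.star M w ⊩ θ)
M , w ⊩ ⋀ I θ   = ∀ i → M , w ⊩ θ i
M , w ⊩ ⋁ I θ   = Σ[ i ∈ I ] M , w ⊩ θ i
M , w ⊩ θ ⟶ χ   = ∀ a b → Model.R M w a b → M , a ⊩ θ → M , b ⊩ χ

variablesOf : {PROP : Set ℓ} → Relevant PROP → Pred PROP ℓ
variablesOf (prop p) q = p ≡ q
variablesOf bot      q = ⊥
variablesOf (∼ θ)    q = variablesOf θ q
variablesOf (⋀ I θ)  q = Σ[ i ∈ I ] variablesOf (θ i) q
variablesOf (⋁ I θ)  q = Σ[ i ∈ I ] variablesOf (θ i) q
variablesOf (θ ⟶ χ)  q = variablesOf θ q ⊎ variablesOf χ q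

------------------------------------------------------------------------
-- The correspondence language

data Term (n : ℕ) : Set where
  var  : Fin n → Term n
  T    : Term n
  star : Term n → Term n

-- Formulas whose free individual variables are de Bruijn indices in Fin n.
-- Γ lists the arities of the relation variables that a second-order prefix
-- may bind; L^corr itself is the case Γ = []. Relation variables are kept
-- apart from the predicates pred p, so only the latter count as
-- non-quantified.

data Formula (PROP : Set ℓ) (Γ : List ℕ) (n : ℕ) : Set (suc ℓ) where
  _≐_  : Term n → Term n → Formula PROP Γ n
  rel  : Term n → Term n → Term n → Formula PROP Γ n
  pred : PROP → Term n → Formula PROP Γ n
  app  : (X : Fin (List.length Γ)) → Vec (Term n) (List.lookup Γ X) →
         Formula PROP Γ n
  neg  : Formula PROP Γ n → Formula PROP Γ n
  ⋀    : (I : Set ℓ) → (I → Formula PROP Γ n) → Formula PROP Γ n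
  ⋁    : (I : Set ℓ) → (I → Formula PROP Γ n) → Formula PROP Γ n
  all  : Formula PROP Γ (ℕ.suc n) → Formula PROP Γ n
  ex   : Formula PROP Γ (ℕ.suc n) → Formula PROP Γ n

Sentence : Set ℓ → Set (suc ℓ)
Sentence PROP = Formula PROP [] 0

Interpretation : List ℕ → Set ℓ → Set (suc ℓ)
Interpretation {ℓ} Γ A =
  (X : Fin (List.length Γ)) → Pred (Vec A (List.lookup Γ X)) ℓ

module _ {PROP : Set ℓ} (M : Model PROP) where

  ⟦_⟧ : ∀ {n} → Term n → Vec (W M) n → W M
  ⟦ var x ⟧  e = Vec.lookup e x
  ⟦ T ⟧      e = Model.T M
  ⟦ star t ⟧ e = Model.star M (⟦ t ⟧ e)

  Sat : ∀ {Γ n} → Interpretation Γ (W M) → Vec (W M) n →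
        Formula PROP Γ n → Set ℓ
  Sat ρ e (s ≐ t)     = ⟦ s ⟧ e ≡ ⟦ t ⟧ e
  Sat ρ e (rel s t u) = Model.R M (⟦ s ⟧ e) (⟦ t ⟧ e) (⟦ u ⟧ e)
  Sat ρ e (pred p t)  = ⟦ t ⟧ e ∈ Model.V M p
  Sat ρ e (app X ts)  = Vec.map (λ t → ⟦ t ⟧ e) ts ∈ ρ X
  Sat ρ e (neg χ)     = ¬ Sat ρ e χ
  Sat ρ e (⋀ I χ)     = ∀ i → Sat ρ e (χ i)
  Sat ρ e (⋁ I χ)     = Σ[ i ∈ I ] Sat ρ e (χ i)
  Sat ρ e (all χ)     = ∀ a → Sat ρ (a ∷ e) χ
  Sat ρ e (ex χ)      = ∃ λ a → Sat ρ (a ∷ e) χ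

predicatesOf : {PROP : Set ℓ} {Γ : List ℕ} {n : ℕ} →
               Formula PROP Γ n → Pred PROP ℓ
predicatesOf (s ≐ t)     q = ⊥
predicatesOf (rel s t u) q = ⊥
predicatesOf (pred p t)  q = p ≡ q
predicatesOf (app X ts)  q = ⊥
predicatesOf (neg χ)     q = predicatesOf χ q
predicatesOf (⋀ I χ)     q = Σ[ i ∈ I ] predicatesOf (χ i) q
predicatesOf (⋁ I χ)     q = Σ[ i ∈ I ] predicatesOf (χ i) q
predicatesOf (all χ)     q = predicatesOf χ q
predicatesOf (ex χ)      q = predicatesOf χ q

infix 4 _⊨_

_⊨_ : {PROP : Set ℓ} → Model PROP → Sentence PROP → Set ℓ
M ⊨ σ = Sat M (λ ()) [] σ

-- A finite string of existential (universal) quantifiers over relation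
-- variables of the listed arities, followed by a formula in the single free
-- individual variable x.

record Σ¹₁ (PROP : Set ℓ) : Set (suc ℓ) where
  constructor ∃₂[_]_
  field
    arities : List ℕ
    matrix  : Formula PROP arities 1

record Π¹₁ (PROP : Set ℓ) : Set (suc ℓ) where
  constructor ∀₂[_]_
  field
    arities : List ℕ
    matrix  : Formula PROP arities 1

infix 4 _⊨Σ_[_] _⊨Π_[_]

_⊨Σ_[_] : {PROP : Set ℓ} (M : Model PROP) → Σ¹₁ PROP → W M → Set (suc ℓ)
M ⊨Σ ∃₂[ Γ ] χ [ w ] =
  Σ[ ρ ∈ Interpretation Γ (W M) ] Sat M ρ (w ∷ []) χ

_⊨Π_[_] : {PROP : Set ℓ} (M : Model PROP) → Π¹₁ PROP → W M → Set (suc ℓ)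
M ⊨Π ∀₂[ Γ ] χ [ w ] =
  (ρ : Interpretation Γ (W M)) → Sat M ρ (w ∷ []) χ

PROPΣ : {PROP : Set ℓ} → Σ¹₁ PROP → Pred PROP ℓ
PROPΣ φ = predicatesOf (Σ¹₁.matrix φ)

PROPΠ : {PROP : Set ℓ} → Π¹₁ PROP → Pred PROP ℓ
PROPΠ ψ = predicatesOf (Π¹₁.matrix ψ)

_Axiomatizes_ : {PROP : Set ℓ} → Sentence PROP → Pred (Model PROP) k →
                Set (suc ℓ ⊔ k)
σ Axiomatizes K = ∀ M → M ∈ K ⇔ M ⊨ σ

------------------------------------------------------------------------
-- Relevant directed bisimulations

-- Clauses (1)–(3) for one of the two choices of {i , j} = {1 , 2}.

record Directed {PROP : Set ℓ} (P : Pred PROP ℓ) (Mᵢ Mⱼ : Model PROP)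
                (Zᵢ : REL (W Mᵢ) (W Mⱼ) ℓ) (Zⱼ : REL (W Mⱼ) (W Mᵢ) ℓ) :
                Set ℓ where
  field
    star-swap : ∀ {x y} → Zᵢ x y → Zⱼ (Model.star Mⱼ y) (Model.star Mᵢ x)
    back      : ∀ {x y b c} → Zᵢ x y → Model.R Mⱼ y b c →
                ∃ λ b′ → ∃ λ c′ → Model.R Mᵢ x b′ c′ × Zⱼ b b′ × Zᵢ c′ c
    atoms     : ∀ {x y p} → Zᵢ x y → p ∈ P →
                Mᵢ , x ⊩ prop p → Mⱼ , y ⊩ prop p

record IsDirectedBisimulation
         {PROP : Set ℓ} (P : Pred PROP ℓ) (M₁ M₂ : Model PROP)
         (Z₁ : REL (W M₁) (W M₂) ℓ) (Z₂ : REL (W M₂) (W M₁) ℓ) :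
         Set ℓ where
  field
    nonEmpty₁ : NonEmpty Z₁
    nonEmpty₂ : NonEmpty Z₂
    directed₁ : Directed P M₁ M₂ Z₁ Z₂
    directed₂ : Directed P M₂ M₁ Z₂ Z₁

ImpliesAlongDirectedBisimulations :
  {PROP : Set ℓ} → Pred PROP ℓ → Pred (Model PROP) k →
  Σ¹₁ PROP → Π¹₁ PROP → Set (suc ℓ ⊔ k)
ImpliesAlongDirectedBisimulations {ℓ} {PROP = PROP} P K φ ψ =
  (M₁ M₂ : Model PROP) → M₁ ∈ K → M₂ ∈ K →
  (Z₁ : REL (W M₁) (W M₂) ℓ) (Z₂ : REL (W M₂) (W M₁) ℓ) →
  IsDirectedBisimulation P M₁ M₂ Z₁ Z₂ →
  (∀ a b → Z₁ a b → M₁ ⊨Σ φ [ a ] → M₂ ⊨Π ψ [ b ]) ×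
  (∀ a b → Z₂ a b → M₂ ⊨Σ φ [ a ] → M₁ ⊨Π ψ [ b ])

------------------------------------------------------------------------
-- Interpolants

record IsRelevantInterpolant
         {PROP : Set ℓ} (K : Pred (Model PROP) k)
         (φ : Σ¹₁ PROP) (ψ : Π¹₁ PROP) (θ : Relevant PROP) :
         Set (suc ℓ ⊔ k) where
  field
    variables : variablesOf θ ⊆ PROPΣ φ ∩ PROPΠ ψ
    from-φ    : ∀ M → M ∈ K → ∀ w → M ⊨Σ φ [ w ] → M , w ⊩ θ
    to-ψ      : ∀ M → M ∈ K → ∀ w → M , w ⊩ θ → M ⊨Π ψ [ w ]

{-# OPTIONS --safe #-}
module Submission where

-- Without an interpolant, every set F of relevant formulas over the common
-- variables has a model of φ and a model of ¬ψ whose distinguished worlds agree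
-- on F, since the conjunctions of formulas of F realised with φ are small in
-- number. Agreement on `next F` is one step of a directed bisimulation into
-- agreement on F, so sets of formulas do the work of ordinals: as in the proof
-- that L∞ω cannot define well-order, a pigeonhole argument on the types of
-- Skolem terms, of which there is only a set, yields an ω-chain of such steps
-- in a single pair of term models. The union of the chain is a directed
-- bisimulation from a world satisfying φ to a world refuting ψ.

open import Defs
open import Level using (Level; suc; Lift; lift; lower)
open import Axiom.ExcludedMiddle using (ExcludedMiddle)
open import Axiom.Extensionality.Propositional
  using (Extensionality; lower-extensionality)
open import Axiom.UniquenessOfIdentityProofs.WithK using (uip)
open import Data.Bool.Base using (Bool; true; false; if_then_else_)
  renaming (T to True)
import Data.Empty.Polymorphic as Polymorphic
open import Data.Fin.Base as Fin using (Fin; inject₁)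
open import Data.List.Base as List using (List; [])
open import Data.Nat.Base as ℕ using (ℕ; _≤_; _<_; _⊔_; s≤s; ≤′-refl; ≤′-step)
open import Data.Nat.Properties
  using (≤-refl; ≤-trans; ≤⇒≤′; ≤′⇒≤; m⊔n≤o⇒m≤o; m⊔n≤o⇒n≤o; m≤m⊔n; m≤n⊔m;
         m≤n⇒m<n∨m≡n)
open import Data.Product.Base using (Σ; ∃; _×_; _,_; proj₁; proj₂)
open import Data.Sum.Base using (_⊎_; inj₁; inj₂)
open import Data.Unit.Polymorphic using (⊤; tt)
open import Data.Vec.Base as Vec using (Vec; []; _∷_; _∷ʳ_)
open import Function.Base using (_∘_; id)
open import Function.Bundles using (_⇔_; mk⇔; Equivalence)
open import Function.Construct.Composition using (_⇔-∘_)
open import Function.Construct.Identity using (⇔-id)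
open import Function.Construct.Symmetry using (⇔-sym)
open import Function.Related.TypeIsomorphisms using (¬-cong-⇔)
open import Relation.Binary.Core using (REL)
open import Relation.Binary.Definitions using (nonEmpty)
open import Relation.Binary.PropositionalEquality
  using (_≡_; refl; sym; trans; cong; cong₂; subst; subst₂)
open import Relation.Nullary.Decidable.Core
  using (Dec; yes; no; isYes; map′; toWitness; fromWitness;
         decidable-stable)
open import Relation.Nullary.Negation.Core using (¬_; contradiction)
open import Relation.Unary using (Pred; _∈_; _⊆_; _∩_)

open Equivalence using (to; from)

private
  variable
    ℓ k k′ : Level

-- Preservation along directed bisimulations

module _ {PROP : Set ℓ} {P : Pred PROP ℓ} where

  -- Negation and the antecedent of an arrow reverse the direction, so the induction runs on both
  -- halves of the pair at once.
  preservation :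
    {M N : Model PROP} {Z : REL (W M) (W N) ℓ} {Z⁻ : REL (W N) (W M) ℓ} →
    Directed P M N Z Z⁻ → Directed P N M Z⁻ Z →
    ∀ θ → variablesOf θ ⊆ P → ∀ {x y} → Z x y → M , x ⊩ θ → N , y ⊩ θ
  preservation D D⁻ (prop p) θ⊆P xZy = Directed.atoms D xZy (θ⊆P refl)
  preservation D D⁻ (∼ θ) θ⊆P xZy x⊮θ y⊩θ =
    x⊮θ (preservation D⁻ D θ θ⊆P (Directed.star-swap D xZy) y⊩θ)
  preservation D D⁻ (⋀ I θ) θ⊆P xZy x⊩θ i =
    preservation D D⁻ (θ i) (λ p → θ⊆P (i , p)) xZy (x⊩θ i)
  preservation D D⁻ (⋁ I θ) θ⊆P xZy (i , x⊩θ) =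
    i , preservation D D⁻ (θ i) (λ p → θ⊆P (i , p)) xZy x⊩θ
  preservation D D⁻ (θ ⟶ χ) θ⊆P xZy x⊩θ⟶χ b c Rybc b⊩θ =
    let b′ , c′ , Rxb′c′ , bZb′ , c′Zc = Directed.back D xZy Rybc in
    preservation D D⁻ χ (θ⊆P ∘ inj₂) c′Zc
      (x⊩θ⟶χ b′ c′ Rxb′c′ (preservation D⁻ D θ (θ⊆P ∘ inj₁) bZb′ b⊩θ))

-- Weakening

weakenTerm : ∀ {n} → Term n → Term (ℕ.suc n)
weakenTerm (var x)  = var (inject₁ x)
weakenTerm T        = T
weakenTerm (star t) = star (weakenTerm t)

-- The new variable is the outermost one, at the far end of the environment, so the recursion passes
-- binders without shifting indices.
weaken : {PROP : Set ℓ} {Γ : List ℕ} {n : ℕ} →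
         Formula PROP [] n → Formula PROP Γ (ℕ.suc n)
weaken (s ≐ t)     = weakenTerm s ≐ weakenTerm t
weaken (rel s t u) = rel (weakenTerm s) (weakenTerm t) (weakenTerm u)
weaken (pred p t)  = pred p (weakenTerm t)
weaken (app () ts)
weaken (neg χ)     = neg (weaken χ)
weaken (⋀ I χ)     = ⋀ I λ i → weaken (χ i)
weaken (⋁ I χ)     = ⋁ I λ i → weaken (χ i)
weaken (all χ)     = all (weaken χ)
weaken (ex χ)      = ex (weaken χ)

lookup-∷ʳ : ∀ {A : Set ℓ} {n} (e : Vec A n) {a : A} x →
            Vec.lookup (e ∷ʳ a) (inject₁ x) ≡ Vec.lookup e x
lookup-∷ʳ (b ∷ e) Fin.zero    = refl
lookup-∷ʳ (b ∷ e) (Fin.suc x) = lookup-∷ʳ e x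

≡⇒⇔ : {A B : Set k} → A ≡ B → A ⇔ B
≡⇒⇔ refl = ⇔-id _

module _ {PROP : Set ℓ} (M : Model PROP) {Γ : List ℕ}
         (ρ : Interpretation Γ (W M)) (ρ₀ : Interpretation [] (W M)) where

  weakenTerm-sat : ∀ {n} (t : Term n) e {a} →
                   ⟦_⟧ M (weakenTerm t) (e ∷ʳ a) ≡ ⟦_⟧ M t e
  weakenTerm-sat (var x)  e = lookup-∷ʳ e x
  weakenTerm-sat T        e = refl
  weakenTerm-sat (star t) e = cong (Model.star M) (weakenTerm-sat t e)

  weaken-sat : ∀ {n} (χ : Formula PROP [] n) e {a} →
               Sat M ρ (e ∷ʳ a) (weaken {Γ = Γ} χ) ⇔ Sat M ρ₀ e χ
  weaken-sat (s ≐ t) e =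
    ≡⇒⇔ (cong₂ _≡_ (weakenTerm-sat s e) (weakenTerm-sat t e))
  weaken-sat (rel s t u) e {a}
    rewrite weakenTerm-sat s e {a} | weakenTerm-sat t e {a}
          | weakenTerm-sat u e {a} = ⇔-id _
  weaken-sat (pred p t) e = ≡⇒⇔ (cong (Model.V M p) (weakenTerm-sat t e))
  weaken-sat (app () ts)
  weaken-sat (neg χ) e = ¬-cong-⇔ (weaken-sat χ e)
  weaken-sat (⋀ I χ) e =
    mk⇔ (λ h i → to (weaken-sat (χ i) e) (h i))
        (λ h i → from (weaken-sat (χ i) e) (h i))
  weaken-sat (⋁ I χ) e =
    mk⇔ (λ (i , h) → i , to (weaken-sat (χ i) e) h)
        (λ (i , h) → i , from (weaken-sat (χ i) e) h)
  weaken-sat (all χ) e =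
    mk⇔ (λ h a → to (weaken-sat χ (a ∷ e)) (h a))
        (λ h a → from (weaken-sat χ (a ∷ e)) (h a))
  weaken-sat (ex χ) e =
    mk⇔ (λ (a , h) → a , to (weaken-sat χ (a ∷ e)) h)
        (λ (a , h) → a , from (weaken-sat χ (a ∷ e)) h)

-- Positions of subformulas

-- Formulas form a large type; the subformulas of a given one are indexed by
-- a small type, which is what makes the types of scenarios below small.

module _ {PROP : Set ℓ} {Γ : List ℕ} where

  Position Inner : ∀ {m} → Formula PROP Γ m → ℕ → Set ℓ
  Position {m} χ n = Lift ℓ (m ≡ n) ⊎ Inner χ n
  Inner (neg χ)     n = Position χ n
  Inner (⋀ I χ)     n = Σ I λ i → Position (χ i) n
  Inner (⋁ I χ)     n = Σ I λ i → Position (χ i) n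
  Inner (all χ)     n = Position χ n
  Inner (ex χ)      n = Position χ n
  Inner _           n = Polymorphic.⊥

  subformula : ∀ {m n} (χ : Formula PROP Γ m) → Position χ n → Formula PROP Γ n
  subformula χ           (inj₁ (lift refl)) = χ
  subformula (neg χ)     (inj₂ q)       = subformula χ q
  subformula (⋀ I χ)     (inj₂ (i , q)) = subformula (χ i) q
  subformula (⋁ I χ)     (inj₂ (i , q)) = subformula (χ i) q
  subformula (all χ)     (inj₂ q)       = subformula χ q
  subformula (ex χ)      (inj₂ q)       = subformula χ q

  -- The equation lets `truth` recur on the formula itself while its position is carried alongside.
  _occursIn_ : ∀ {m n} → Formula PROP Γ n → Formula PROP Γ m → Set (suc ℓ)
  ζ occursIn χ = ∃ λ q → subformula χ q ≡ ζ

  Children : (∀ {n} → Formula PROP Γ n → Set (suc ℓ)) →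
             ∀ {n} → Formula PROP Γ n → Set (suc ℓ)
  Children C (neg χ)     = C χ
  Children C (⋀ I χ)     = ∀ i → C (χ i)
  Children C (⋁ I χ)     = ∀ i → C (χ i)
  Children C (all χ)     = C χ
  Children C (ex χ)      = C χ
  Children C _           = ⊤

  Children-map : {C D : ∀ {n} → Formula PROP Γ n → Set (suc ℓ)} →
                 (∀ {n} {ζ : Formula PROP Γ n} → C ζ → D ζ) →
                 ∀ {n} (ζ : Formula PROP Γ n) → Children C ζ → Children D ζ
  Children-map f (s ≐ t)     c = tt
  Children-map f (rel s t u) c = tt
  Children-map f (pred p t)  c = tt
  Children-map f (app X ts)  c = tt
  Children-map f (neg χ)     c = f c
  Children-map f (⋀ I χ)     c = λ i → f (c i)
  Children-map f (⋁ I χ)     c = λ i → f (c i)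
  Children-map f (all χ)     c = f c
  Children-map f (ex χ)      c = f c

  here : ∀ {m} (χ : Formula PROP Γ m) → χ occursIn χ
  here χ = inj₁ (lift refl) , refl

  children-root : ∀ {m} (χ : Formula PROP Γ m) → Children (_occursIn χ) χ
  children-root (s ≐ t)     = tt
  children-root (rel s t u) = tt
  children-root (pred p t)  = tt
  children-root (app X ts)  = tt
  children-root (neg χ)     = inj₂ (inj₁ (lift refl)) , refl
  children-root (⋀ I χ)     = λ i → inj₂ (i , inj₁ (lift refl)) , refl
  children-root (⋁ I χ)     = λ i → inj₂ (i , inj₁ (lift refl)) , refl
  children-root (all χ)     = inj₂ (inj₁ (lift refl)) , refl
  children-root (ex χ)      = inj₂ (inj₁ (lift refl)) , refl

  children-subformula : ∀ {m n} (χ : Formula PROP Γ m) (q : Position χ n) →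
                        Children (_occursIn χ) (subformula χ q)
  children-subformula χ           (inj₁ (lift refl)) = children-root χ
  children-subformula (neg χ) (inj₂ q) =
    Children-map (λ (r , eq) → inj₂ r , eq)
      (subformula χ q) (children-subformula χ q)
  children-subformula (⋀ I χ) (inj₂ (i , q)) =
    Children-map (λ (r , eq) → inj₂ (i , r) , eq)
      (subformula (χ i) q) (children-subformula (χ i) q)
  children-subformula (⋁ I χ) (inj₂ (i , q)) =
    Children-map (λ (r , eq) → inj₂ (i , r) , eq)
      (subformula (χ i) q) (children-subformula (χ i) q)
  children-subformula (all χ) (inj₂ q) =
    Children-map (λ (r , eq) → inj₂ r , eq)
      (subformula χ q) (children-subformula χ q)
  children-subformula (ex χ) (inj₂ q) =
    Children-map (λ (r , eq) → inj₂ r , eq)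
      (subformula χ q) (children-subformula χ q)

  children : ∀ {m n} {χ : Formula PROP Γ m} {ζ : Formula PROP Γ n} →
             ζ occursIn χ → Children (_occursIn χ) ζ
  children {χ = χ} (q , refl) = children-subformula χ q

-- Choice from excluded middle

module Classical {ℓ : Level} (em : ExcludedMiddle (suc ℓ)) where

  decide : (A : Set ℓ) → Dec A
  decide A = map′ lower lift (em {Lift (suc ℓ) A})

  abstract

    -- Deciding a Σ-type yields a witness, so excluded middle acts as a choice operator; `a` is the
    -- value when `Q` is empty.
    choose : {A : Set ℓ} → Pred A ℓ → A → A
    choose {A} Q a with decide (∃ Q)
    ... | yes (b , _) = b
    ... | no _        = a

    choose-spec : {A : Set ℓ} (Q : Pred A ℓ) (a : A) → ∃ Q → choose Q a ∈ Q
    choose-spec Q a q with decide (∃ Q)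
    ... | yes (_ , h) = h
    ... | no ¬q       = contradiction q ¬q

    -- Boolean truth values keep the predicates on a small type small; subsets of a family, types
    -- and equivalence classes are coded this way.
    bit : Set ℓ → Bool
    bit A = isYes (decide A)

    bit-sound : {A : Set ℓ} → True (bit A) → A
    bit-sound = toWitness

    bit-complete : {A : Set ℓ} → A → True (bit A)
    bit-complete = fromWitness

    bit-cong : {A B : Set ℓ} → A ⇔ B → bit A ≡ bit B
    bit-cong {A} {B} A⇔B with decide A | decide B
    ... | yes a | yes b = refl
    ... | yes a | no ¬b = contradiction (to A⇔B a) ¬b
    ... | no ¬a | yes b = contradiction (from A⇔B b) ¬a
    ... | no ¬a | no ¬b = refl

    bit-injective : {A B : Set ℓ} → bit A ≡ bit B → A ⇔ B
    bit-injective {A} {B} eq =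
      mk⇔ (λ a → bit-sound (subst True eq (bit-complete a)))
          (λ b → bit-sound (subst True (sym eq) (bit-complete b)))

-- Finite approximations of a directed bisimulation

module _ {PROP : Set ℓ} (P : Pred PROP ℓ) where

  record Family : Set (suc ℓ) where
    field
      Code   : Set ℓ
      ⟪_⟫    : Code → Relevant PROP
      within : ∀ c → variablesOf ⟪ c ⟫ ⊆ P

  -- The clauses of `Directed` at one pair, except that the pairs produced are required in relations
  -- `Z` and `Z⁻` that need not relate `x` and `y`.
  record Matches (M N : Model PROP) (x : W M) (y : W N)
                 (Z : REL (W M) (W N) ℓ) (Z⁻ : REL (W N) (W M) ℓ) :
                 Set ℓ where
    field
      star-swap : Z⁻ (Model.star N y) (Model.star M x)
      back      : ∀ {b c} → Model.R N y b c →
                  ∃ λ b′ → ∃ λ c′ → Model.R M x b′ c′ × Z⁻ b b′ × Z c′ c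
      atoms     : ∀ {p} → p ∈ P → x ∈ Model.V M p → y ∈ Model.V N p

module _ {PROP : Set ℓ} {P : Pred PROP ℓ} where

  open Family

  Agree : Family P → (M N : Model PROP) → REL (W M) (W N) ℓ
  Agree F M N x y = ∀ c → M , x ⊩ ⟪ F ⟫ c → N , y ⊩ ⟪ F ⟫ c

  ⋃ : (I : Set ℓ) → (I → Family P) → Family P
  ⋃ I F .Code             = Σ I λ i → Code (F i)
  ⋃ I F .⟪_⟫ (i , c)      = ⟪ F i ⟫ c
  ⋃ I F .within (i , c)   = within (F i) c

  data NextCode (C : Set ℓ) : Set ℓ where
    atom  : ∀ p → p ∈ P → NextCode C
    notᶜ  : C → NextCode C
    arrow : (C → Bool) → (C → Bool) → NextCode C

  module _ (F : Family P) where

    ⟪_⟫⁺ : NextCode (Code F) → Relevant PROP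
    ⟪ atom p _  ⟫⁺ = prop p
    ⟪ notᶜ c    ⟫⁺ = ∼ ⟪ F ⟫ c
    ⟪ arrow A B ⟫⁺ = ⋀ (∃ λ c → True (A c)) (⟪ F ⟫ ∘ proj₁) ⟶
                     ⋁ (∃ λ c → True (B c)) (⟪ F ⟫ ∘ proj₁)

    next : Family P
    next .Code = NextCode (Code F)
    next .⟪_⟫  = ⟪_⟫⁺
    next .within (atom p p∈P) refl                  = p∈P
    next .within (notᶜ c)     v                     = within F c v
    next .within (arrow A B)  (inj₁ ((c , _) , v)) = within F c v
    next .within (arrow A B)  (inj₂ ((c , _) , v)) = within F c v

    open Classical

    -- Failure of back at R y b c is witnessed by the implication from the
    -- formulas true at b to the disjunction of those false at c.

    agree-matches : ExcludedMiddle (suc ℓ) → {M N : Model PROP} → ∀ {x y} →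
                    Agree next M N x y →
                    Matches P M N x y (Agree F M N) (Agree F N M)
    agree-matches em {M} {N} {x} {y} x≼y = record
      { star-swap = λ c y*⊩c → decidable-stable (decide em _) λ x*⊮c →
                    x≼y (notᶜ c) x*⊮c y*⊩c
      ; back      = λ Rybc → decidable-stable (decide em _) (back Rybc)
      ; atoms     = λ p∈P → x≼y (atom _ p∈P)
      }
      where
      back : ∀ {b c} → Model.R N y b c →
             ¬ ¬ (∃ λ b′ → ∃ λ c′ → Model.R M x b′ c′ ×
                  Agree F N M b b′ × Agree F M N c′ c)
      back {b} {c} Rybc none =
        let d , c⊩d = x≼y (arrow true-at-b false-at-c) x⊩ b c Rybc
                        (λ (d , b⊩d) → bit-sound em b⊩d)
        in bit-sound em (proj₂ d) c⊩d
        where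
        true-at-b false-at-c : Code F → Bool
        true-at-b  d = bit em (N , b ⊩ ⟪ F ⟫ d)
        false-at-c d = bit em (¬ (N , c ⊩ ⟪ F ⟫ d))
        x⊩ : M , x ⊩ ⟪ arrow true-at-b false-at-c ⟫⁺
        -- If `c′` satisfied nothing in `false-at-c`, then `b′` and `c′` would be the answer that
        -- `none` rules out.
        x⊩ b′ c′ Rxb′c′ b′⊩ = decidable-stable (decide em _) λ c′⊮ →
          none (b′ , c′ , Rxb′c′ ,
            (λ d b⊩d → b′⊩ (d , bit-complete em b⊩d)) ,
            (λ d c′⊩d → decidable-stable (decide em _) λ c⊮d →
              c′⊮ ((d , bit-complete em c⊮d) , c′⊩d)))

-- Skolem terms and chains of relations

⊔-split : ∀ m n {o} → m ⊔ n ≤ o → m ≤ o × n ≤ o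
⊔-split m n h = m⊔n≤o⇒m≤o m n h , m⊔n≤o⇒n≤o m n h

-- Index `n` still comes from `f`; everything from `suc n` on is `a`. A scenario of length `n`
-- constrains its relations only up to `n`, so the tail may be overwritten.
extend : {A : Set k} → ℕ → (ℕ → A) → A → ℕ → A
extend n         f a ℕ.zero    = f 0
extend ℕ.zero    f a (ℕ.suc k) = a
extend (ℕ.suc n) f a (ℕ.suc k) = extend n (f ∘ ℕ.suc) a k

extend-≤ : ∀ {A : Set k} n (f : ℕ → A) a m → m ≤ n → f m ≡ extend n f a m
extend-≤ n         f a ℕ.zero    h       = refl
extend-≤ (ℕ.suc n) f a (ℕ.suc m) (s≤s h) = extend-≤ n (f ∘ ℕ.suc) a m h

extend-suc : ∀ {A : Set k} n (f : ℕ → A) a → extend n f a (ℕ.suc n) ≡ a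
extend-suc ℕ.zero    f a = refl
extend-suc (ℕ.suc n) f a = extend-suc n (f ∘ ℕ.suc) a

-- Worlds of the term model are fixed points of `representative`; this makes them equal as soon as
-- their terms are.
fixedPoint-≡ : {A : Set k} {f : A → A} {a b : A} {p : f a ≡ a} {q : f b ≡ b} →
               a ≡ b → (a , p) ≡ (b , q)
fixedPoint-≡ {p = p} {q} refl = cong (_ ,_) (uip p q)

cong₃ : {A B C : Set ℓ} {D : Set k} (f : A → B → C → D) → ∀ {a a′ b b′ c c′} →
        a ≡ a′ → b ≡ b′ → c ≡ c′ → f a b c ≡ f a′ b′ c′
cong₃ f refl refl refl = refl

data Side : Set where
  left right : Side

module Compactness
  {ℓ : Level} (em : ExcludedMiddle (suc ℓ)) (ext : Extensionality ℓ ℓ)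
  {PROP : Set ℓ} (P : Pred PROP ℓ)
  (Γ : Side → List ℕ) (Φ : ∀ s → Formula PROP (Γ s) 1)
  where

  open Classical em

  -- The left model is to satisfy φ and the right one to refute ψ; indexing both by `Side` lets each
  -- construction be done once.
  record Structure : Set (suc ℓ) where
    field
      M     : Side → Model PROP
      ρ     : ∀ s → Interpretation (Γ s) (W (M s))
      start : ∀ s → W (M s)
      holds : ∀ s → Sat (M s) (ρ s) (start s ∷ []) (Φ s)

    World : Side → Set ℓ
    World s = W (M s)

    -- The pairs with i = j are harmless, and including them spares a case
    -- distinction on {i , j} = {1 , 2}.

    Relations : Set (suc ℓ)
    Relations = ∀ i j → REL (World i) (World j) ℓ

    AllMatch : Relations → Relations → Set ℓ
    AllMatch Z Z′ = ∀ i j x y → Z i j x y →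
                    Matches P (M i) (M j) x y (Z′ i j) (Z′ j i)

    AgreeOn : Family P → Relations
    AgreeOn F i j = Agree F (M i) (M j)

  open Structure

  -- skolem true and skolem false name a witness and a counterexample of a
  -- subformula; answer true k and answer false k name the worlds b′ and c′ that
  -- back provides with respect to the k-th relations of a chain.

  data STerm : Side → Set ℓ where
    origin : ∀ {s} → STerm s
    T      : ∀ {s} → STerm s
    star   : ∀ {s} → STerm s → STerm s
    skolem : ∀ {s n} → Bool → Position (Φ s) (ℕ.suc n) → Vec (STerm s) n →
             STerm s
    answer : ∀ {i j} → Bool → ℕ → STerm i → (b c : STerm j) → STerm i

  -- The facts that must pass to the limit. Satisfaction of a subformula is an atom of its own,
  -- which makes it stable along the scenarios without an induction on formulas.
  data Atom : Set ℓ where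
    formula : ∀ {s n} → Position (Φ s) n → Vec (STerm s) n → Atom
    equal   : ∀ {s} (t u : STerm s) → Atom
    rel     : ∀ {s} (t u v : STerm s) → Atom
    pred    : ∀ {s} → PROP → STerm s → Atom
    app     : ∀ {s} X → Vec (STerm s) (List.lookup (Γ s) X) → Atom
    related : ℕ → ∀ {i j} → STerm i → STerm j → Atom

  -- Bounds the indices of the chain relations that evaluation consults, so a change of the chain
  -- beyond it has no effect.
  boundᵗ : ∀ {s} → STerm s → ℕ
  boundᵛ : ∀ {s n} → Vec (STerm s) n → ℕ
  boundᵗ origin             = 0
  boundᵗ T                  = 0
  boundᵗ (star t)           = boundᵗ t
  boundᵗ (skolem f q ts)    = boundᵛ ts
  boundᵗ (answer f k x b c) = k ⊔ (boundᵗ x ⊔ (boundᵗ b ⊔ boundᵗ c))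
  boundᵛ []                 = 0
  boundᵛ (t ∷ ts)           = boundᵗ t ⊔ boundᵛ ts

  bound : Atom → ℕ
  bound (formula q ts)  = boundᵛ ts
  bound (equal t u)     = boundᵗ t ⊔ boundᵗ u
  bound (rel t u v)     = boundᵗ t ⊔ (boundᵗ u ⊔ boundᵗ v)
  bound (pred p t)      = boundᵗ t
  bound (app X ts)      = boundᵛ ts
  bound (related k t u) = k ⊔ (boundᵗ t ⊔ boundᵗ u)

  module _ (S : Structure) where

    Answers : ∀ {i j} (Zᵢⱼ : REL (World S i) (World S j) ℓ)
              (Zⱼᵢ : REL (World S j) (World S i) ℓ) →
              World S i → (b c : World S j) → Pred (World S i × World S i) ℓ
    Answers Zᵢⱼ Zⱼᵢ x b c (b′ , c′) =
      Model.R (M S _) x b′ c′ × Zⱼᵢ b b′ × Zᵢⱼ c′ c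

    -- Both worlds come from a single choice, so `answer true` and `answer false` fit together.
    response : ∀ {i j} → Relations S → World S i → (b c : World S j) →
             World S i × World S i
    response {i} {j} Z x b c =
      choose (Answers (Z i j) (Z j i) x b c) (Model.T (M S i) , Model.T (M S i))

    Decides : ∀ {s n} → Bool → Formula PROP (Γ s) (ℕ.suc n) →
              Vec (World S s) n → Pred (World S s) ℓ
    Decides true  χ e w = Sat (M S _) (ρ S _) (w ∷ e) χ
    Decides false χ e w = ¬ Sat (M S _) (ρ S _) (w ∷ e) χ

    module _ (Z : ℕ → Relations S) where

      eval  : ∀ {s} → STerm s → World S s
      evals : ∀ {s n} → Vec (STerm s) n → Vec (World S s) n
      eval origin             = start S _
      eval T                  = Model.T (M S _)
      eval (star t)           = Model.star (M S _) (eval t)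
      eval (skolem f q ts)    =
        choose (Decides f (subformula (Φ _) q) (evals ts)) (Model.T (M S _))
      eval (answer f k x b c) =
        (if f then proj₁ else proj₂) (response (Z k) (eval x) (eval b) (eval c))
      evals []                = []
      evals (t ∷ ts)          = eval t ∷ evals ts

      Holds : Atom → Set ℓ
      Holds (formula q ts)  =
        Sat (M S _) (ρ S _) (evals ts) (subformula (Φ _) q)
      Holds (equal t u)     = eval t ≡ eval u
      Holds (rel t u v)     = Model.R (M S _) (eval t) (eval u) (eval v)
      Holds (pred p t)      = eval t ∈ Model.V (M S _) p
      Holds (app X ts)      = evals ts ∈ ρ S _ X
      Holds (related k t u) = Z k _ _ (eval t) (eval u)

    module _ {Z Z′ : ℕ → Relations S} {n : ℕ}
             (Z≡Z′ : ∀ k → k ≤ n → Z k ≡ Z′ k) where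

      eval-cong  : ∀ {s} (t : STerm s) → boundᵗ t ≤ n → eval Z t ≡ eval Z′ t
      evals-cong : ∀ {s m} (ts : Vec (STerm s) m) → boundᵛ ts ≤ n →
                   evals Z ts ≡ evals Z′ ts
      eval-cong origin          _ = refl
      eval-cong T               _ = refl
      eval-cong (star t)        h = cong (Model.star (M S _)) (eval-cong t h)
      eval-cong (skolem f q ts) h rewrite evals-cong ts h = refl
      eval-cong (answer f k x b c) h
        with k≤n , h ← ⊔-split k _ h
        with x≤n , h ← ⊔-split (boundᵗ x) _ h
        with b≤n , c≤n ← ⊔-split (boundᵗ b) _ h
        rewrite Z≡Z′ k k≤n | eval-cong x x≤n | eval-cong b b≤n
              | eval-cong c c≤n = refl
      evals-cong []       _ = refl
      evals-cong (t ∷ ts) h =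
        let t≤n , ts≤n = ⊔-split (boundᵗ t) _ h in
        cong₂ _∷_ (eval-cong t t≤n) (evals-cong ts ts≤n)

      Holds-cong : ∀ a → bound a ≤ n → Holds Z a ≡ Holds Z′ a
      Holds-cong (formula q ts) h rewrite evals-cong ts h = refl
      Holds-cong (equal t u) h =
        let t≤n , u≤n = ⊔-split (boundᵗ t) _ h in
        cong₂ _≡_ (eval-cong t t≤n) (eval-cong u u≤n)
      Holds-cong (rel t u v) h
        with t≤n , h ← ⊔-split (boundᵗ t) _ h
        with u≤n , v≤n ← ⊔-split (boundᵗ u) _ h
        rewrite eval-cong t t≤n | eval-cong u u≤n | eval-cong v v≤n = refl
      Holds-cong (pred p t) h = cong (Model.V (M S _) p) (eval-cong t h)
      Holds-cong (app X ts) h = cong (ρ S _ X) (evals-cong ts h)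
      Holds-cong (related k t u) h
        with k≤n , h ← ⊔-split k _ h
        with t≤n , u≤n ← ⊔-split (boundᵗ t) _ h
        rewrite Z≡Z′ k k≤n | eval-cong t t≤n | eval-cong u u≤n = refl


  -- Finite chains, their types and the pigeonhole argument

  record Scenario (n : ℕ) : Set (suc ℓ) where
    field
      S     : Structure
      Z     : ℕ → Relations S
      seed  : Z 0 left right (start S left) (start S right)
      chain : ∀ m → m < n → AllMatch S (Z m) (Z (ℕ.suc m))

  open Scenario

  -- Measures how far the chain can still be continued: `F` takes the place of the ordinal left at
  -- the last relation.
  Deep : ∀ {n} → Family P → Scenario n → Set ℓ
  Deep {n} F s = ∀ i j x y → Z s n i j x y → AgreeOn (S s) F i j x y

  Type : Set ℓ
  Type = Atom → Bool

  typeOf : ∀ {n} → Scenario n → Type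
  typeOf s a = bit (Holds (S s) (Z s) a)

  _≈[_]_ : Type → ℕ → Type → Set ℓ
  t ≈[ n ] u = ∀ a → bound a ≤ n → t a ≡ u a

  -- Agreement on `F` is appended as relation `suc n`; `agree-matches` turns the old depth `next F`
  -- into the new step. Atoms of bound at most `n` see only the earlier relations.
  deepen : ∀ {n} F (s : Scenario n) → Deep (next F) s →
           Σ (Scenario (ℕ.suc n)) λ s⁺ → Deep F s⁺ × typeOf s ≈[ n ] typeOf s⁺
  deepen {n} F s deep = s⁺ , deep⁺ , same
    where
    Z⁺ : ℕ → Relations (S s)
    Z⁺ = extend n (Z s) (AgreeOn (S s) F)

    Z≡Z⁺ : ∀ m → m ≤ n → Z s m ≡ Z⁺ m
    Z≡Z⁺ = extend-≤ n (Z s) _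

    Z⁺-last : Z⁺ (ℕ.suc n) ≡ AgreeOn (S s) F
    Z⁺-last = extend-suc n (Z s) _

    chain⁺ : ∀ m → m ≤ n → AllMatch (S s) (Z⁺ m) (Z⁺ (ℕ.suc m))
    chain⁺ m m≤n with m≤n⇒m<n∨m≡n m≤n
    ... | inj₁ m<n  =
      subst₂ (AllMatch (S s)) (Z≡Z⁺ m m≤n) (Z≡Z⁺ _ m<n) (chain s m m<n)
    ... | inj₂ refl =
      subst₂ (AllMatch (S s)) (Z≡Z⁺ m m≤n) (sym Z⁺-last)
        λ i j x y xZy → agree-matches F em (deep i j x y xZy)

    s⁺ : Scenario (ℕ.suc n)
    s⁺ .S               = S s
    s⁺ .Z               = Z⁺
    s⁺ .seed            = seed s
    s⁺ .chain m (s≤s h) = chain⁺ m h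

    deep⁺ : Deep F s⁺
    deep⁺ i j x y =
      subst (λ Y → Y i j x y → AgreeOn (S s) F i j x y) (sym Z⁺-last) id

    same : typeOf s ≈[ n ] typeOf s⁺
    same a h = cong bit (Holds-cong (S s) Z≡Z⁺ a h)

  -- Only a set of types is available for a proper class of families; if every
  -- type were bounded, the union of the bounds would admit no type at all.

  pigeonhole : (Q : Type → Family P → Set (suc ℓ)) →
               (∀ {t I} (F : I → Family P) i → Q t (⋃ I F) → Q t (F i)) →
               (∀ F → ∃ λ t → Q t F) → ∃ λ t → ∀ F → Q t F
  pigeonhole Q antitone some = decidable-stable em λ none →
    let bounded : ∀ t → ∃ λ F → ¬ Q t F
        bounded t = decidable-stable em λ unbounded → none (t , λ F →
          decidable-stable em λ ¬q → unbounded (F , ¬q))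
        t , q = some (⋃ Type (proj₁ ∘ bounded))
    in proj₂ (bounded t) (antitone (proj₁ ∘ bounded) t q)

  Realised : ℕ → Type → Family P → Set (suc ℓ)
  Realised n t F = Σ (Scenario n) λ s → Deep F s × t ≈[ n ] typeOf s

  realised-antitone : ∀ {n t I} (F : I → Family P) i →
                      Realised n t (⋃ I F) → Realised n t (F i)
  realised-antitone F i (s , deep , t≈s) =
    s , (λ j k x y xZy c → deep j k x y xZy (i , c)) , t≈s

  -- The analogue of being realised at unboundedly many ordinals: whatever depth a continuation
  -- costs, some scenario of this type has it.
  Persistent : ℕ → Type → Set (suc ℓ)
  Persistent n t = ∀ F → Realised n t F

  persist : ∀ {n t} → Persistent n t →
            ∃ λ t⁺ → Persistent (ℕ.suc n) t⁺ × t ≈[ n ] t⁺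
  persist {n} {t} realise =
    let t⁺ , q = pigeonhole
          (λ u F → Realised (ℕ.suc n) u F × t ≈[ n ] u)
          (λ G i (r , t≈u) → realised-antitone G i r , t≈u)
          λ F → let s , deep , t≈s = realise (next F)
                    s⁺ , deep⁺ , s≈s⁺ = deepen F s deep
                in typeOf s⁺ , (s⁺ , deep⁺ , λ a h → refl) ,
                   λ a h → trans (t≈s a h) (s≈s⁺ a h)
    -- The second conjunct does not mention the family, so it is read off at the empty one.
    in t⁺ , proj₁ ∘ q , proj₂ (q (⋃ Polymorphic.⊥ λ ()))

  module _ (approximations : ∀ F → ∃ λ S →
            AgreeOn S F left right (start S left) (start S right)) where

    limitTypes : ∀ n → ∃ (Persistent n)
    limitTypes ℕ.zero = pigeonhole (Realised 0) realised-antitone λ F →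
      let S , h = approximations F
          s : Scenario 0
          s = record
            { S = S ; Z = λ _ → AgreeOn S F ; seed = h ; chain = λ _ () }
      in typeOf s , s , (λ i j x y xZy → xZy) , λ a h → refl
    limitTypes (ℕ.suc n) =
      let t⁺ , q , _ = persist (proj₂ (limitTypes n)) in t⁺ , q

    limitTypes-coherent : ∀ {m n} → m ℕ.≤′ n →
                          proj₁ (limitTypes m) ≈[ m ] proj₁ (limitTypes n)
    limitTypes-coherent ≤′-refl         a h = refl
    limitTypes-coherent (≤′-step {n} m≤n) a h = trans
      (limitTypes-coherent m≤n a h)
      (proj₂ (proj₂ (persist (proj₂ (limitTypes n)))) a (≤-trans h (≤′⇒≤ m≤n)))

    scenarios : ∀ n → Scenario n
    scenarios n = proj₁ (proj₂ (limitTypes n) (⋃ Polymorphic.⊥ λ ()))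

    scenarios-type : ∀ n → proj₁ (limitTypes n) ≈[ n ] typeOf (scenarios n)
    scenarios-type n =
      proj₂ (proj₂ (proj₂ (limitTypes n) (⋃ Polymorphic.⊥ λ ())))

    -- Scenarios of different lengths may live in unrelated structures; coherence comes from the
    -- persistent types, fixed beforehand by iterating `persist`.
    scenarios-coherent : ∀ {m n} → m ≤ n →
                         typeOf (scenarios m) ≈[ m ] typeOf (scenarios n)
    scenarios-coherent {m} {n} m≤n a h =
      trans (sym (scenarios-type m a h))
      (trans (limitTypes-coherent (≤⇒≤′ m≤n) a h)
             (scenarios-type n a (≤-trans h m≤n)))

  -- The term model of a coherent sequence of scenarios

  module TermModel (scenario : ∀ n → Scenario n)
    (coherent : ∀ {m n} → m ≤ n →
                typeOf (scenario m) ≈[ m ] typeOf (scenario n))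
    where

    HoldsAt : ℕ → Atom → Set ℓ
    HoldsAt n = Holds (S (scenario n)) (Z (scenario n))

    -- A record, so that the atom can be inferred from the proposition.

    record Limit (a : Atom) : Set ℓ where
      constructor limit
      field
        holdsAtBound : HoldsAt (bound a) a

    Eventually : Pred ℕ k → Set k
    Eventually Q = ∃ λ m → ∀ n → m ≤ n → Q n

    infixr 4 _&_
    _&_ : {Q : Pred ℕ k} {Q′ : Pred ℕ k′} →
          Eventually Q → Eventually Q′ → Eventually (Q ∩ Q′)
    (m , q) & (m′ , q′) = m ⊔ m′ , λ n h →
      let m≤n , m′≤n = ⊔-split m m′ h in q n m≤n , q′ n m′≤n

    extract : {Q : Pred ℕ k} {A : Set k′} → Eventually Q → (∀ n → Q n → A) → A
    extract (m , q) f = f m (q m ≤-refl)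

    atLeast : ∀ m → Eventually (m ≤_)
    atLeast m = m , λ n m≤n → m≤n

    -- From its bound on, an atom has the same truth value in all scenarios, so facts about the
    -- limit can be proved at any late stage.
    stable : ∀ a → Eventually (λ n → Limit a ⇔ HoldsAt n a)
    stable a = bound a , λ n h →
      let a⇔ = bit-injective (coherent h a ≤-refl)
      in mk⇔ (λ (limit l) → to a⇔ l) (λ l → limit (from a⇔ l))

    value : ∀ n {s} → STerm s → World (S (scenario n)) s
    value n = eval (S (scenario n)) (Z (scenario n))

    values : ∀ n {s m} → Vec (STerm s) m → Vec (World (S (scenario n)) s) m
    values n = evals (S (scenario n)) (Z (scenario n))

    model : ℕ → ∀ s → Model PROP
    model n = M (S (scenario n))

    _~_ : ∀ {s} → STerm s → STerm s → Set ℓ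
    t ~ u = Limit (equal t u)

    ~-value : ∀ {s} {t u : STerm s} → t ~ u →
              Eventually (λ n → value n t ≡ value n u)
    ~-value t~u =
      let m , h = stable (equal _ _) in m , λ n m≤n → to (h n m≤n) t~u

    ~-refl : ∀ {s} {t : STerm s} → t ~ t
    ~-refl = limit refl

    ~-sym : ∀ {s} {t u : STerm s} → t ~ u → u ~ t
    ~-sym t~u =
      extract (~-value t~u & stable (equal _ _)) λ n (eq , h) → from h (sym eq)

    ~-trans : ∀ {s} {t u v : STerm s} → t ~ u → u ~ v → t ~ v
    ~-trans t~u u~v = extract (~-value t~u & ~-value u~v & stable (equal _ _))
      λ n (eq , eq′ , h) → from h (trans eq eq′)

    -- For Boolean-valued classes, extensionality makes those of related terms equal, and `member`
    -- then picks the same term from both.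
    class : ∀ {s} → STerm s → STerm s → Bool
    class t u = bit (t ~ u)

    class-cong : ∀ {s} {t u : STerm s} → t ~ u → class t ≡ class u
    class-cong t~u = lower-extensionality ℓ ℓ ext λ v →
      bit-cong (mk⇔ (~-trans (~-sym t~u)) (~-trans t~u))

    member : ∀ {s} → (STerm s → Bool) → STerm s
    member f = choose (λ u → f ≡ class u) origin

    representative : ∀ {s} → STerm s → STerm s
    representative t = member (class t)

    ~-representative : ∀ {s} (t : STerm s) → t ~ representative t
    ~-representative t = bit-sound (subst (λ f → True (f r)) (sym class≡)
                                          (bit-complete (~-refl {t = r})))
      where
      r = representative t
      class≡ : class t ≡ class r
      class≡ = choose-spec (λ u → class t ≡ class u) origin (t , refl)

    representative-cong : ∀ {s} {t u : STerm s} → t ~ u →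
                          representative t ≡ representative u
    representative-cong t~u = cong member (class-cong t~u)

    -- The quotient of the terms by `_~_`: equality in the correspondence language is read as `_≡_`,
    -- so related terms must become one world.
    LimitWorld : Side → Set ℓ
    LimitWorld s = Σ (STerm s) λ t → representative t ≡ t

    [_] : ∀ {s} → STerm s → LimitWorld s
    [ t ] = representative t ,
            sym (representative-cong (~-representative t))

    limitModel : Side → Model PROP
    limitModel s .Model.W       = LimitWorld s
    limitModel s .Model.R x y z = Limit (rel (proj₁ x) (proj₁ y) (proj₁ z))
    limitModel s .Model.star x  = [ star (proj₁ x) ]
    limitModel s .Model.T       = [ T ]
    limitModel s .Model.V p x   = Limit (pred p (proj₁ x))

    limitInterpretation : ∀ s → Interpretation (Γ s) (LimitWorld s)
    limitInterpretation s X xs = Limit (app X (Vec.map proj₁ xs))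

    ⟨_⟩ : ∀ {s} → LimitWorld s → ∀ n → World (S (scenario n)) s
    ⟨ x ⟩ n = value n (proj₁ x)

    ⟨_⟩* : ∀ {s m} → Vec (LimitWorld s) m → ∀ n →
           Vec (World (S (scenario n)) s) m
    ⟨ xs ⟩* n = values n (Vec.map proj₁ xs)

    ⟨[_]⟩ : ∀ {s} (t : STerm s) → Eventually (λ n → ⟨ [ t ] ⟩ n ≡ value n t)
    ⟨[ t ]⟩ = let m , h = ~-value (~-representative t)
              in m , λ n m≤n → sym (h n m≤n)

    LimitWorld-≡ : ∀ {s} {x y : LimitWorld s} → proj₁ x ~ proj₁ y → x ≡ y
    LimitWorld-≡ {x = t , p} {u , q} t~u =
      fixedPoint-≡ (trans (sym p) (trans (representative-cong t~u) q))

    ⟨lookup⟩ : ∀ {s m} (e : Vec (LimitWorld s) m) x n →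
               ⟨ Vec.lookup e x ⟩ n ≡ Vec.lookup (⟨ e ⟩* n) x
    ⟨lookup⟩ (_ ∷ e) Fin.zero    n = refl
    ⟨lookup⟩ (_ ∷ e) (Fin.suc x) n = ⟨lookup⟩ e x n

    ⟨term⟩ : ∀ {s m} (t : Term m) (e : Vec (LimitWorld s) m) → Eventually λ n →
             ⟨ ⟦_⟧ (limitModel s) t e ⟩ n ≡ ⟦_⟧ (model n s) t (⟨ e ⟩* n)
    ⟨term⟩ (var x)  e = 0 , λ n _ → ⟨lookup⟩ e x n
    ⟨term⟩ T        e = ⟨[ T ]⟩
    ⟨term⟩ {s} (star t) e =
      let m , h = ⟨[ star (proj₁ (⟦_⟧ (limitModel s) t e)) ]⟩ & ⟨term⟩ t e in
      m , λ n m≤n → let eq , eq′ = h n m≤n in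
        trans eq (cong (Model.star (model n s)) eq′)

    ⟨terms⟩ : ∀ {s m l} (ts : Vec (Term m) l) (e : Vec (LimitWorld s) m) →
              Eventually λ n →
              ⟨ Vec.map (λ t → ⟦_⟧ (limitModel s) t e) ts ⟩* n ≡
              Vec.map (λ t → ⟦_⟧ (model n s) t (⟨ e ⟩* n)) ts
    ⟨terms⟩ []       e = 0 , λ n _ → refl
    ⟨terms⟩ (t ∷ ts) e = let m , h = ⟨term⟩ t e & ⟨terms⟩ ts e in
      m , λ n m≤n → let eq , eq′ = h n m≤n in cong₂ _∷_ eq eq′

    -- Truth in the term model

    SatAt : ∀ n {s m} → Vec (LimitWorld s) m → Formula PROP (Γ s) m → Set ℓ
    SatAt n e = Sat (model n _) (ρ (S (scenario n)) _) (⟨ e ⟩* n)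

    rank : ∀ {s m} → Vec (LimitWorld s) m → ℕ
    rank e = boundᵛ (Vec.map proj₁ e)

    SatAt-stable : ∀ {s m} {χ : Formula PROP (Γ s) m} → χ occursIn Φ s →
                   ∀ e {n n′} → rank e ≤ n → rank e ≤ n′ →
                   SatAt n e χ ⇔ SatAt n′ e χ
    SatAt-stable (q , refl) e n≥ n′≥ =
      let _ , h = stable (formula q (Vec.map proj₁ e))
      in h _ n′≥ ⇔-∘ ⇔-sym (h _ n≥)

    -- An equivalence proved late moves back to every stage from `rank e` on, by stability of the
    -- atom `formula`. The threshold in `truth` thus depends on `e` alone, and infinitely many
    -- conjuncts can share it.
    settle : ∀ {A : Set ℓ} {s m} {χ : Formula PROP (Γ s) m} →
             χ occursIn Φ s → ∀ e → Eventually (λ n → A ⇔ SatAt n e χ) →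
             ∀ {n} → rank e ≤ n → A ⇔ SatAt n e χ
    settle o e (m , h) {n} n≥ = 
      SatAt-stable o e (≤-trans n≥ (m≤n⊔m m n)) n≥ ⇔-∘ h (m ⊔ n) (m≤m⊔n m n)

    SatLimit : ∀ {s m} → Vec (LimitWorld s) m → Formula PROP (Γ s) m → Set ℓ
    SatLimit e = Sat (limitModel _) (limitInterpretation _) e

    -- The term is fixed before `n`, so one world of the limit serves at every stage.
    skolem-spec : ∀ f {s m} {χ : Formula PROP (Γ s) (ℕ.suc m)} →
                  χ occursIn Φ s → ∀ e → ∃ λ t → ∀ n →
                  let Q = Decides (S (scenario n)) {s} f χ (⟨ e ⟩* n) in
                  ∃ Q → Q (value n t)
    skolem-spec f (q , refl) e =
      skolem f q (Vec.map proj₁ e) , λ n → choose-spec _ _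

    truth : ∀ {s m} (χ : Formula PROP (Γ s) m) → χ occursIn Φ s →
            ∀ e {n} → rank e ≤ n → SatLimit e χ ⇔ SatAt n e χ
    truth (s ≐ t) o e = settle o e
      (let m , h = ⟨term⟩ s e & ⟨term⟩ t e & stable (equal _ _) in
       m , λ n m≤n → let eq , eq′ , ~⇔ = h n m≤n in
       mk⇔ (λ s≡t → trans (sym eq) (trans (cong (λ x → ⟨ x ⟩ n) s≡t) eq′))
           (λ s≡t → LimitWorld-≡ (from ~⇔ (trans eq (trans s≡t (sym eq′))))))
    truth (rel s t u) o e = settle o e
      (let m , h = ⟨term⟩ s e & ⟨term⟩ t e & ⟨term⟩ u e & stable (rel _ _ _) in
       m , λ n m≤n → let eq₁ , eq₂ , eq₃ , l = h n m≤n in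
       ≡⇒⇔ (cong₃ (Model.R (model n _)) eq₁ eq₂ eq₃) ⇔-∘ l)
    truth (pred p t) o e = settle o e
      (let m , h = ⟨term⟩ t e & stable (pred p _) in
       m , λ n m≤n → let eq , l = h n m≤n in
       ≡⇒⇔ (cong (Model.V (model n _) p) eq) ⇔-∘ l)
    truth (app X ts) o e = settle o e
      (let m , h = ⟨terms⟩ ts e & stable (app X _) in
       m , λ n m≤n → let eq , l = h n m≤n in
       ≡⇒⇔ (cong (ρ (S (scenario n)) _ X) eq) ⇔-∘ l)
    truth (neg χ) o e n≥ = ¬-cong-⇔ (truth χ (children o) e n≥)
    truth (⋀ I χ) o e n≥ =
      mk⇔ (λ h i → to (truth (χ i) (children o i) e n≥) (h i))
          (λ h i → from (truth (χ i) (children o i) e n≥) (h i))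
    truth (⋁ I χ) o e n≥ =
      mk⇔ (λ (i , h) → i , to (truth (χ i) (children o i) e n≥) h)
          (λ (i , h) → i , from (truth (χ i) (children o i) e n≥) h)
    truth {s} (all χ) o e = settle o e
      (let t , counterexample = skolem-spec false (children o) e
           m , h = ⟨[ t ]⟩ & atLeast (rank ([ t ] ∷ e)) & atLeast (rank e) in
       m , λ n m≤n → let eq , n≥ , n≥′ = h n m≤n in
       mk⇔ (λ ∀χ a → decidable-stable (decide _) λ ¬χ →
              counterexample n (a , ¬χ)
              (subst (λ w → Sat _ _ (w ∷ ⟨ e ⟩* n) χ) eq
                     (to (truth χ (children o) ([ t ] ∷ e) n≥) (∀χ [ t ]))))
           -- The rank of `a` may exceed `n`, so the hypothesis is first carried to stage `n ⊔ r`,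
           -- where the induction hypothesis applies to `a ∷ e`.
           (λ ∀χ a → let r = rank (a ∷ e) in
              from (truth χ (children o) (a ∷ e) (m≤n⊔m n r))
                   (to (SatAt-stable o e n≥′ (≤-trans n≥′ (m≤m⊔n n r))) ∀χ
                       (⟨ a ⟩ (n ⊔ r)))))
    truth (ex χ) o e = settle o e
      (let t , witness = skolem-spec true (children o) e
           m , h = ⟨[ t ]⟩ & atLeast (rank ([ t ] ∷ e)) & atLeast (rank e) in
       m , λ n m≤n → let eq , n≥ , n≥′ = h n m≤n in
       mk⇔ (λ (a , χa) → let r = rank (a ∷ e) in
              from (SatAt-stable o e n≥′ (≤-trans n≥′ (m≤m⊔n n r)))
                   (⟨ a ⟩ (n ⊔ r) ,
                    to (truth χ (children o) (a ∷ e) (m≤n⊔m n r)) χa))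
           (λ ∃χ → [ t ] ,
              from (truth χ (children o) ([ t ] ∷ e) n≥)
                   (subst (λ w → Sat _ _ (w ∷ ⟨ e ⟩* n) χ) (sym eq)
                          (witness n ∃χ))))

    limitModel-satisfies : ∀ s → SatLimit ([ origin ] ∷ []) (Φ s)
    limitModel-satisfies s =
      extract (⟨[ origin ]⟩ & atLeast (rank ([ origin ] ∷ []))) λ n (eq , n≥) →
      from (truth (Φ s) (here (Φ s)) _ n≥)
           (subst (λ w → Sat _ _ (w ∷ []) (Φ s)) (sym eq)
                  (holds (S (scenario n)) s))

    -- The directed bisimulation between the term models

    LimitRelated : ∀ i j → REL (LimitWorld i) (LimitWorld j) ℓ
    LimitRelated i j x y = ∃ λ m → Limit (related m (proj₁ x) (proj₁ y))

    origins-related : LimitRelated left right [ origin ] [ origin ]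
    origins-related = 0 ,
      extract (⟨[ origin {left} ]⟩ & ⟨[ origin {right} ]⟩ &
               stable (related 0 _ _))
        λ n (eq , eq′ , h) → from h
          (subst₂ (Z (scenario n) 0 left right) (sym eq) (sym eq′)
                  (seed (scenario n)))

    module _ {i j : Side} where

      matches : ∀ {m} {x : STerm i} {y : STerm j} →
                Limit (related m x y) → Eventually λ n →
                Matches P (model n i) (model n j) (value n x) (value n y)
                          (Z (scenario n) (ℕ.suc m) i j)
                          (Z (scenario n) (ℕ.suc m) j i)
      matches {m} l =
        -- Only scenarios longer than `m` provide the step from relation `m` to relation `suc m`.
        let m′ , h = stable (related m _ _) & atLeast (ℕ.suc m) in
        m′ , λ n m′≤n → let l⇔ , m<n = h n m′≤n in
          chain (scenario n) m m<n i j _ _ (to l⇔ l)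

      -- The answers to a pair of level `m` are related at level `suc m`, still inside the union.
      -- The `answer` terms name them independently of the stage.
      limit-back : ∀ {m} (x : LimitWorld i) (y b c : LimitWorld j) →
                   Limit (related m (proj₁ x) (proj₁ y)) →
                   Model.R (limitModel j) y b c → ∃ λ b′ → ∃ λ c′ →
                   Model.R (limitModel i) x b′ c′ ×
                   LimitRelated j i b b′ × LimitRelated i j c′ c
      limit-back {m} x y b c l Rybc =
        let Rxb′c′ , bZb′ , c′Zc =
              extract (matches l & stable (rel _ _ _) &
                       ⟨[ t true ]⟩ & ⟨[ t false ]⟩ & stable (rel _ _ _) &
                       stable (related (ℕ.suc m) _ _) &
                       stable (related (ℕ.suc m) _ _)) answered
        in [ t true ] , [ t false ] , Rxb′c′ , (_ , bZb′) , (_ , c′Zc)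
        where
        t : Bool → STerm i
        t f = answer f (ℕ.suc m) (proj₁ x) (proj₁ b) (proj₁ c)

        answered : ∀ n → _ →
                   Limit (rel (proj₁ x) (proj₁ [ t true ]) (proj₁ [ t false ])) ×
                   Limit (related (ℕ.suc m) (proj₁ b) (proj₁ [ t true ])) ×
                   Limit (related (ℕ.suc m) (proj₁ [ t false ]) (proj₁ c))
        answered n (match , R⇔ , eq , eq′ , R⇔′ , Z⇔ , Z⇔′) =
          let b′ , c′ , answers = Matches.back match (to R⇔ Rybc)
              Rxb′c′ , bZb′ , c′Zc = choose-spec
                (Answers (S (scenario n)) (Z (scenario n) (ℕ.suc m) i j)
                         (Z (scenario n) (ℕ.suc m) j i) _ _ _) _
                ((b′ , c′) , answers)
          in from R⇔′
               (subst₂ (Model.R (model n i) _) (sym eq) (sym eq′) Rxb′c′) ,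
             from Z⇔ (subst (Z (scenario n) _ _ _ _) (sym eq) bZb′) ,
             from Z⇔′ (subst (λ w → Z (scenario n) _ _ _ w _) (sym eq′) c′Zc)

      limit-directed : Directed P (limitModel i) (limitModel j)
                                (LimitRelated i j) (LimitRelated j i)
      limit-directed = record
        { star-swap = λ {x} {y} (m , l) → ℕ.suc m ,
            extract (matches l & ⟨[ star (proj₁ y) ]⟩ & ⟨[ star (proj₁ x) ]⟩ &
                     stable (related (ℕ.suc m) _ _))
              λ n (match , eq , eq′ , h) → from h
                (subst₂ (Z (scenario n) _ _ _) (sym eq) (sym eq′)
                        (Matches.star-swap match))
        ; back      = λ {x} {y} {b} {c} (m , l) → limit-back x y b c l
        ; atoms     = λ {p = p} (m , l) p∈P v →
            extract (matches l & stable (pred p _) & stable (pred p _))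
              λ n (match , h , h′) → from h′ (Matches.atoms match p∈P (to h v))
        }

    limitStructure : Structure
    limitStructure = record
      { M     = limitModel
      ; ρ     = limitInterpretation
      ; start = λ _ → [ origin ]
      ; holds = limitModel-satisfies
      }

    limit-bisimulation :
      IsDirectedBisimulation P (limitModel left) (limitModel right)
                             (LimitRelated left right) (LimitRelated right left)
    limit-bisimulation = record
      { nonEmpty₁ = nonEmpty {x = [ origin ]} {[ origin ]} origins-related
      -- The seed relates left to right only; `star-swap` at the origins gives a pair in the other
      -- direction.
      ; nonEmpty₂ = nonEmpty
          {x = [ star (proj₁ [ origin ]) ]} {[ star (proj₁ [ origin ]) ]}
          (Directed.star-swap limit-directed {[ origin ]} {[ origin ]}
            origins-related)
      ; directed₁ = limit-directed
      ; directed₂ = limit-directed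
      }

  compactness :
    (∀ F → ∃ λ S → AgreeOn S F left right (start S left) (start S right)) →
    ∃ λ S → ∃ λ Z₁ → ∃ λ Z₂ →
    IsDirectedBisimulation P (M S left) (M S right) Z₁ Z₂ ×
    Z₁ (start S left) (start S right)
  compactness approximations =
    limitStructure , _ , _ , limit-bisimulation , origins-related
    where
    open TermModel (scenarios approximations) (scenarios-coherent approximations)

-- Interpolants

-- Including σ in the formulas of both sides puts the two limit models into the axiomatized class.
conjunction : {PROP : Set ℓ} {Γ : List ℕ} →
              Sentence PROP → Formula PROP Γ 1 → Formula PROP Γ 1
conjunction σ χ = ⋀ (Lift _ Bool) λ (lift b) → if b then weaken σ else χ

conjunction-sat : {PROP : Set ℓ} (σ : Sentence PROP) (M : Model PROP)
                  (Γ : List ℕ) (ρ : Interpretation Γ (W M)) (w : W M)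
                  (χ : Formula PROP Γ 1) →
                  Sat M ρ (w ∷ []) (conjunction σ χ) ⇔
                  (M ⊨ σ × Sat M ρ (w ∷ []) χ)
conjunction-sat σ M Γ ρ w χ = mk⇔
  (λ h → to (weaken-sat M ρ (λ ()) σ []) (h (lift true)) , h (lift false))
  λ (M⊨σ , h) → λ where
    (lift true)  → from (weaken-sat M ρ (λ ()) σ []) M⊨σ
    (lift false) → h

module Interpolation {ℓ : Level} (em : ExcludedMiddle (suc ℓ))
  (ext : Extensionality ℓ ℓ) {PROP : Set ℓ} (φ : Σ¹₁ PROP) (ψ : Π¹₁ PROP)
  (σ : Sentence PROP) where

  open Classical em

  Common : Pred PROP ℓ
  Common = PROPΣ φ ∩ PROPΠ ψ

  open Family

  module _ (F : Family Common) where

    Contains : (Code F → Bool) → ∀ M → Pred (W M) ℓ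
    Contains A M w = ∀ c → M , w ⊩ ⟪ F ⟫ c → True (A c)

    Realisable : (Code F → Bool) → Set (suc ℓ)
    Realisable A = ∃ λ M → M ⊨ σ × ∃ λ w → M ⊨Σ φ [ w ] × Contains A M w

    -- `Realisable` lives one universe up; deciding it makes the index set of the disjunction small.
    -- `Contains` asks only that `A` include what holds at `w`, which suffices for any world
    -- satisfying the conjunction of `A` to inherit it.
    candidate : Relevant PROP
    candidate = ⋁ (∃ λ A → True (isYes (em {Realisable A}))) λ (A , _) →
                ⋀ (∃ λ c → True (A c)) (⟪ F ⟫ ∘ proj₁)

    candidate-variables : variablesOf candidate ⊆ Common
    candidate-variables ((A , _) , (c , _) , v) = within F c v

    candidate-from-φ : ∀ M → M ⊨ σ → ∀ w → M ⊨Σ φ [ w ] → M , w ⊩ candidate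
    candidate-from-φ M M⊨σ w φw =
      ((λ c → bit (M , w ⊩ ⟪ F ⟫ c)) ,
       fromWitness (M , M⊨σ , w , φw , λ c → bit-complete)) ,
      λ (c , h) → bit-sound h

    Sufficient : Set (suc ℓ)
    Sufficient = ∀ M → M ⊨ σ → ∀ w → M , w ⊩ candidate → M ⊨Π ψ [ w ]

  Γ : Side → List ℕ
  Γ left  = Σ¹₁.arities φ
  Γ right = Π¹₁.arities ψ

  Φ : ∀ s → Formula PROP (Γ s) 1
  Φ left  = conjunction σ (Σ¹₁.matrix φ)
  Φ right = conjunction σ (neg (Π¹₁.matrix ψ))

  open Compactness em ext Common Γ Φ
  open Structure

  -- A world refuting ψ where the candidate holds satisfies all of some realisable `A`; a world of φ
  -- realising `A` then agrees with it on `F`.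
  separate : ∀ F → ¬ Sufficient F →
             ∃ λ S → AgreeOn S F left right (start S left) (start S right)
  separate F insufficient = decidable-stable em λ none →
    insufficient λ N N⊨σ v ((A , realisable) , A⊆v) ρ →
    decidable-stable (decide _) λ ¬ψv →
    let M , M⊨σ , w , (ρ′ , φw) , w⊆A = toWitness realisable in
    none (record
      { M     = λ { left → M ; right → N }
      ; ρ     = λ { left → ρ′ ; right → ρ }
      ; start = λ { left → w ; right → v }
      ; holds = λ { left  → from (conjunction-sat σ M _ ρ′ w _) (M⊨σ , φw)
                  ; right → from (conjunction-sat σ N _ ρ v _) (N⊨σ , ¬ψv) }
      } , λ c w⊩c → A⊆v (c , w⊆A c w⊩c))

  -- If every family failed, `separate` would feed `compactness`, and the resulting bisimulation
  -- would lead from φ to a failure of ψ inside `K`.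
  sufficient : {K : Pred (Model PROP) k} → σ Axiomatizes K →
               ImpliesAlongDirectedBisimulations Common K φ ψ → ∃ Sufficient
  sufficient axiom implies = decidable-stable em λ none →
    let S , Z₁ , Z₂ , bisimulation , aZ₁b =
          compactness λ F → separate F λ h → none (F , h)
        M⊨σ , φa  = to (conjunction-sat σ _ _ (ρ S left) _ _) (holds S left)
        N⊨σ , ¬ψb = to (conjunction-sat σ _ _ (ρ S right) _ _) (holds S right)
    in ¬ψb (proj₁ (implies _ _ (from (axiom _) M⊨σ) (from (axiom _) N⊨σ)
                            Z₁ Z₂ bisimulation)
                   _ _ aZ₁b (ρ S left , φa) (ρ S right))

  interpolate : {K : Pred (Model PROP) k} → σ Axiomatizes K →
                ImpliesAlongDirectedBisimulations Common K φ ψ →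
                ∃ (IsRelevantInterpolant K φ ψ)
  interpolate axiom implies =
    let F , F-sufficient = sufficient axiom implies in
    candidate F , record
      { variables = candidate-variables F
      ; from-φ    = λ M M∈K → candidate-from-φ F M (to (axiom M) M∈K)
      ; to-ψ      = λ M M∈K → F-sufficient M (to (axiom M) M∈K)
      }

interpolant-implies :
  {PROP : Set ℓ} {φ : Σ¹₁ PROP} {ψ : Π¹₁ PROP} {K : Pred (Model PROP) k} →
  ∃ (IsRelevantInterpolant K φ ψ) →
  ImpliesAlongDirectedBisimulations (PROPΣ φ ∩ PROPΠ ψ) K φ ψ
interpolant-implies (θ , interpolant) M₁ M₂ M₁∈K M₂∈K Z₁ Z₂ bisimulation =
  (λ a b aZb φa → to-ψ M₂ M₂∈K b
    (preservation directed₁ directed₂ θ variables aZb (from-φ M₁ M₁∈K a φa))) ,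
  (λ a b aZb φa → to-ψ M₁ M₁∈K b
    (preservation directed₂ directed₁ θ variables aZb (from-φ M₂ M₂∈K a φa)))
  where
  open IsRelevantInterpolant interpolant
  open IsDirectedBisimulation bisimulation

theorem13 : ∀ {ℓ k : Level} → ExcludedMiddle (suc ℓ) → Extensionality ℓ ℓ →
    {PROP : Set ℓ} (φ : Σ¹₁ PROP) (ψ : Π¹₁ PROP)
    (K : Pred (Model PROP) k) (σ : Sentence PROP) → σ Axiomatizes K →
    ImpliesAlongDirectedBisimulations (PROPΣ φ ∩ PROPΠ ψ) K φ ψ ⇔
    ∃ (IsRelevantInterpolant K φ ψ)
theorem13 em ext φ ψ K σ axiom =
  mk⇔ (Interpolation.interpolate em ext φ ψ σ axiom) interpolant-implies
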